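{- Let $\mathcal X_1,\mathcal X_2,\mathcal Y_1,\mathcal Y_2,\mathcal W_1,\mathcal W_2$ be finite nonempty sets, let $g_1:\mathcal W_1\times\mathcal X_1\to[0,1]$ and $g_2:\mathcal W_2\times\mathcal X_2\to[0,1]$ be gain functions, and let $g:(\mathcal W_1\times\mathcal W_2)\times(\mathcal X_1\times\mathcal X_2)\to[0,1]$ be a joint gain function for $g_1,g_2$. For any prior $\pi$ on $\mathcal X_1\times\mathcal X_2$ with marginals $\pi_1$ and $\pi_2$ and with $V_g(\pi)>0$, and any two channels $(\mathcal X_1,\mathcal Y_1,C_1)$ and $(\mathcal X_2,\mathcal Y_2,C_2)$: (1) $H_g(\pi,C_1\times C_2)\ \ge\ H_{g_1}(\pi_1,C_1)+H_{g_2}(\pi_2,C_2)+\log M^{\min}_{g,\pi}$; (2) if $\pi$ is jointly supported, $H_g(\pi,C_1\times C_2)\ \le\ H_{g_1}(\pi_1,C_1)+H_{g_2}(\pi_2,C_2)+\log M^{\max}_{g,\pi}$.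
   Context: A (discrete) channel $(\mathcal X,\mathcal Y,C)$ consists of finite sets $\mathcal X,\mathcal Y$ and a matrix $C$ with entries $C[x,y]\ge 0$ and $\sum_{y}C[x,y]=1$ for each $x$. A prior on $\mathcal X$ is a probability distribution on $\mathcal X$. The parallel composition (with distinct inputs) $C_1\times C_2$ is the channel from $\mathcal X_1\times\mathcal X_2$ to $\mathcal Y_1\times\mathcal Y_2$ with $(C_1\times C_2)[(x_1,x_2),(y_1,y_2)]=C_1[x_1,y_1]\,C_2[x_2,y_2]$. For a gain function $g:\mathcal W\times\mathcal X\to[0,1]$: $V_g(\pi)=\max_{w\in\mathcal W}\sum_{x}\pi[x]g(w,x)$, $V_g(\pi,C)=\sum_{y}\max_{w\in\mathcal W}\sum_x\pi[x]C[x,y]g(w,x)$, and $H_g(\pi,C)=-\log V_g(\pi,C)$. Logarithms are to base 2. A joint gain function $g$ for $g_1,g_2$ is required to satisfy: $g((w_1,w_2),(x_1,x_2))=0$ if and only if $g_1(w_1,x_1)g_2(w_2,x_2)=0$ (no other relation is assumed). The marginals of $\pi$ are $\pi_1[x_1]=\sum_{x_2}\pi[x_1,x_2]$ and $\pi_2[x_2]=\sum_{x_1}\pi[x_1,x_2]$. $\pi$ is jointly supported if for all $x_1,x_2$, $\pi_1[x_1]\pi_2[x_2]\ne 0$ implies $\pi[x_1,x_2]\neq 0$. For $w_1\in\mathcal W_1,w_2\in\mathcal W_2$ let $\mathcal S_{w_1,w_2}=\{(x_1,x_2):\pi[x_1,x_2]\,g((w_1,w_2),(x_1,x_2))\ne0\}$.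 Define $M^{\min}_{g,\pi}$ (resp. $M^{\max}_{g,\pi}$) as the minimum (resp. maximum), over all $(w_1,w_2)\in\mathcal W_1\times\mathcal W_2$ and all $(x_1,x_2)\in\mathcal S_{w_1,w_2}$, of $$\frac{\pi_1[x_1]g_1(w_1,x_1)\cdot\pi_2[x_2]g_2(w_2,x_2)}{\pi[x_1,x_2]\cdot g((w_1,w_2),(x_1,x_2))}.$$ Pairs $(w_1,w_2)$ with $\mathcal S_{w_1,w_2}=\emptyset$ are ignored; $V_g(\pi)>0$ guarantees that some $\mathcal S_{w_1,w_2}$ is nonempty. -}

module Defs where

open import Level using (_⊔_) renaming (suc to lsuc)
open import Algebra.Bundles using (CommutativeRing; Semiring)
open import Algebra.Structures using (IsCommutativeRing)
open import Data.Fin.Base using (Fin; zero; suc; _↑ˡ_; _↑ʳ_; combine; remQuot)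
open import Data.Fin.Properties using (*↔×; remQuot-combine)
open import Data.List.Base using (List; []; _∷_; map; filter; tabulate; cartesianProduct)
open import Data.Nat.Base as ℕ using (ℕ; zero; suc)
open import Data.Product.Base using (∃; ∃-syntax; _×_; _,_; proj₂)
open import Data.Product.Function.NonDependent.Propositional using (_×-↔_)
open import Function.Bundles using (_↔_; _⇔_; Inverse)
open import Function.Properties.Inverse using (↔-trans)
open import Relation.Binary.Bundles using (TotalOrder)
import Relation.Binary.Construct.NonStrictToStrict as NonStrictToStrict
open import Relation.Binary.Core using (Rel)
import Relation.Binary.PropositionalEquality.Core as ≡
open import Relation.Binary.Structures using (IsDecTotalOrder)
open import Relation.Nullary.Decidable.Core using (¬?)
open import Relation.Nullary.Negation.Core using (¬_)

-- The classical real numbers, given by their usual axioms: a Dedekind-complete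
-- totally ordered field.  The order is decidable, as it is classically.  The
-- operations _⁻¹ and sup are total, but nothing is said about 0# ⁻¹ or about
-- the supremum of a set that is empty or unbounded above.

record Reals c ℓ : Set (lsuc (c ⊔ ℓ)) where
  infix  8 _⁻¹
  infixl 7 _*_
  infixl 6 _+_
  infix  4 _≈_ _≤_
  field
    Carrier           : Set c
    _≈_ _≤_           : Rel Carrier ℓ
    _+_ _*_           : Carrier → Carrier → Carrier
    -_ _⁻¹            : Carrier → Carrier
    0# 1#             : Carrier
    sup               : (Carrier → Set ℓ) → Carrier
    isCommutativeRing : IsCommutativeRing _≈_ _+_ _*_ -_ 0# 1#
    isDecTotalOrder   : IsDecTotalOrder _≈_ _≤_
    1≉0               : ¬ 1# ≈ 0#
    ⁻¹-inverseʳ       : ∀ x → ¬ x ≈ 0# → x * x ⁻¹ ≈ 1#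
    +-monoʳ-≤         : ∀ x {y z} → y ≤ z → x + y ≤ x + z
    *-nonneg          : ∀ {x y} → 0# ≤ x → 0# ≤ y → 0# ≤ x * y

  UpperBound : (Carrier → Set ℓ) → Carrier → Set (c ⊔ ℓ)
  UpperBound P b = ∀ x → P x → x ≤ b

  field
    sup-upper : ∀ P → ∃ P → ∃ (UpperBound P) → UpperBound P (sup P)
    sup-least : ∀ P → ∃ P → ∀ b → UpperBound P b → sup P ≤ b

record NonemptyFiniteSet : Set₁ where
  field
    Elem   : Set
    size-1 : ℕ
    enum   : Fin (suc size-1) ↔ Elem

  index : Fin (suc size-1) → Elem
  index = Inverse.to enum

  elements : List Elem
  elements = tabulate index

open NonemptyFiniteSet public using (Elem; elements)
open NonemptyFiniteSet using (size-1; enum; index)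

infixr 7 _⊗_
_⊗_ : NonemptyFiniteSet → NonemptyFiniteSet → NonemptyFiniteSet
A ⊗ B = record
  { Elem   = Elem A × Elem B
  ; size-1 = size-1 B ℕ.+ size-1 A ℕ.* suc (size-1 B)
  ; enum   = ↔-trans (*↔× {suc (size-1 A)} {suc (size-1 B)}) (enum A ×-↔ enum B)
  }

module Leakage {c ℓ} (R : Reals c ℓ) where

  open Reals R public renaming (Carrier to ℝ)
  open IsDecTotalOrder isDecTotalOrder
    using (_≟_; isTotalOrder)
    renaming (refl to ≤-refl; trans to ≤-trans; ≤-resp-≈ to ≤-resp)
  open NonStrictToStrict _≈_ _≤_ public using (_<_)

  ring : CommutativeRing c ℓ
  ring = record { isCommutativeRing = isCommutativeRing }

  totalOrder : TotalOrder c ℓ ℓ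
  totalOrder = record { isTotalOrder = isTotalOrder }

  open CommutativeRing ring
    using (semiring; setoid; +-commutativeMonoid; *-identityʳ; *-congˡ; +-congˡ;
           +-assoc; +-identityˡ; +-identityʳ)
    renaming (refl to ≈-refl; sym to ≈-sym; trans to ≈-trans)
  open import Algebra.Definitions.RawSemiring (Semiring.rawSemiring semiring)
    using (sum; _^_) renaming (_×_ to _·_)
  open import Algebra.Properties.CommutativeMonoid.Sum +-commutativeMonoid
    using (sum-cong-≋; sum-cong-≗; ∑-comm)
  open import Algebra.Properties.Semiring.Sum semiring
    using (*-distribˡ-sum)
  open import Data.List.Extrema totalOrder using (min; max)
  open import Relation.Binary.Reasoning.Setoid setoid

  infixl 7 _÷_
  _÷_ : ℝ → ℝ → ℝ
  x ÷ y = x * y ⁻¹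

  -- t is a rational number (a − b) / (1 + n) with 2 ^ t ≤ x.
  BelowLog₂ : ℝ → ℝ → Set ℓ
  BelowLog₂ x t = ∃[ a ] ∃[ b ] ∃[ n ]
    suc n · t + b · 1# ≈ a · 1# ×
    (1# + 1#) ^ a ≤ (1# + 1#) ^ b * x ^ suc n

  -- The binary logarithm of x > 0, as the supremum of the rationals t with
  -- 2 ^ t ≤ x.  For other x the value is irrelevant.
  log₂ : ℝ → ℝ
  log₂ x = sup (BelowLog₂ x)

  ∑ : (A : NonemptyFiniteSet) → (Elem A → ℝ) → ℝ
  ∑ A f = sum (λ i → f (index A i))

  infixl 5 ∑
  syntax ∑ A (λ x → e) = ∑[ x ∈ A ] e

  -- The value at [] is a dummy.
  minimum maximum : List ℝ → ℝ
  minimum []       = 0#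
  minimum (x ∷ xs) = min x xs
  maximum []       = 0#
  maximum (x ∷ xs) = max x xs

  Max : (A : NonemptyFiniteSet) → (Elem A → ℝ) → ℝ
  Max A f = maximum (map f (elements A))

  infixl 5 Max
  syntax Max A (λ x → e) = Max[ x ∈ A ] e

  record Prior (X : NonemptyFiniteSet) : Set (c ⊔ ℓ) where
    field
      prob   : Elem X → ℝ
      nonneg : ∀ x → 0# ≤ prob x
      total  : ∑[ x ∈ X ] prob x ≈ 1#

  record Channel (X Y : NonemptyFiniteSet) : Set (c ⊔ ℓ) where
    field
      entry  : Elem X → Elem Y → ℝ
      nonneg : ∀ x y → 0# ≤ entry x y
      total  : ∀ x → ∑[ y ∈ Y ] entry x y ≈ 1#

  record GainFunction (W X : NonemptyFiniteSet) : Set (c ⊔ ℓ) where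
    field
      gain   : Elem W → Elem X → ℝ
      nonneg : ∀ w x → 0# ≤ gain w x
      ≤1     : ∀ w x → gain w x ≤ 1#

  open Prior public using (prob)
  open Channel public using (entry)
  open GainFunction public using (gain)

  V : ∀ {W X} → GainFunction W X → Prior X → ℝ
  V {W} {X} g π = Max[ w ∈ W ] ∑[ x ∈ X ] prob π x * gain g w x

  Vᶜ : ∀ {W X Y} → GainFunction W X → Prior X → Channel X Y → ℝ
  Vᶜ {W} {X} {Y} g π C =
    ∑[ y ∈ Y ] Max[ w ∈ W ] ∑[ x ∈ X ] prob π x * entry C x y * gain g w x

  H : ∀ {W X Y} → GainFunction W X → Prior X → Channel X Y → ℝ
  H g π C = - log₂ (Vᶜ g π C)

  +-nonneg : ∀ {x y} → 0# ≤ x → 0# ≤ y → 0# ≤ x + y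
  +-nonneg {x} 0≤x 0≤y =
    ≤-trans 0≤x (proj₂ ≤-resp (+-identityʳ x) (+-monoʳ-≤ x 0≤y))

  sum-nonneg : ∀ {n} (f : Fin n → ℝ) → (∀ i → 0# ≤ f i) → 0# ≤ sum f
  sum-nonneg {zero}  f 0≤f = ≤-refl
  sum-nonneg {suc n} f 0≤f =
    +-nonneg (0≤f zero) (sum-nonneg (λ i → f (suc i)) (λ i → 0≤f (suc i)))

  sum-++ : ∀ m {n} (f : Fin (m ℕ.+ n) → ℝ) →
           sum f ≈ sum (λ i → f (i ↑ˡ n)) + sum (λ j → f (m ↑ʳ j))
  sum-++ zero    f = ≈-sym (+-identityˡ _)
  sum-++ (suc m) f =
    ≈-trans (+-congˡ (sum-++ m (λ i → f (suc i)))) (≈-sym (+-assoc _ _ _))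

  sum-combine : ∀ m {n} (f : Fin (m ℕ.* n) → ℝ) →
                sum f ≈ sum {m} (λ i → sum {n} (λ j → f (combine i j)))
  sum-combine zero        f = ≈-refl
  sum-combine (suc m) {n} f =
    ≈-trans (sum-++ n f) (+-congˡ (sum-combine m (λ k → f (n ↑ʳ k))))

  sum-× : ∀ {m n} (f : Fin m × Fin n → ℝ) →
          sum (λ k → f (remQuot {m} n k)) ≈ sum (λ i → sum (λ j → f (i , j)))
  sum-× {m} {n} f = begin
    sum (λ k → f (remQuot {m} n k))
      ≈⟨ sum-combine m {n} (λ k → f (remQuot {m} n k)) ⟩
    sum {m} (λ i → sum {n} (λ j → f (remQuot {m} n (combine i j))))
      ≡⟨ sum-cong-≗ (λ i → sum-cong-≗ (λ j →
           ≡.cong f (remQuot-combine {m} {n} i j))) ⟩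
    sum (λ i → sum (λ j → f (i , j))) ∎

  ∑-cong : ∀ A (f f′ : Elem A → ℝ) → (∀ a → f a ≈ f′ a) → ∑ A f ≈ ∑ A f′
  ∑-cong A f f′ f≈f′ =
    sum-cong-≋ {_} {λ i → f (index A i)} {λ i → f′ (index A i)} (λ i → f≈f′ (index A i))

  ∑-nonneg : ∀ A {f : Elem A → ℝ} → (∀ a → 0# ≤ f a) → 0# ≤ ∑ A f
  ∑-nonneg A {f} 0≤f = sum-nonneg (λ i → f (index A i)) (λ i → 0≤f (index A i))

  ∑-*ˡ : ∀ A x (f : Elem A → ℝ) → ∑[ a ∈ A ] x * f a ≈ x * ∑ A f
  ∑-*ˡ A x f = ≈-sym (*-distribˡ-sum {suc (size-1 A)} x (λ i → f (index A i)))

  ∑-swap : ∀ A B (f : Elem A → Elem B → ℝ) →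
           ∑[ a ∈ A ] ∑[ b ∈ B ] f a b ≈ ∑[ b ∈ B ] ∑[ a ∈ A ] f a b
  ∑-swap A B f =
    ∑-comm {suc (size-1 A)} {suc (size-1 B)} (λ i j → f (index A i) (index B j))

  ∑-⊗ : ∀ A B (f : Elem (A ⊗ B) → ℝ) →
        ∑ (A ⊗ B) f ≈ ∑[ a ∈ A ] ∑[ b ∈ B ] f (a , b)
  ∑-⊗ A B f = sum-× {suc (size-1 A)} (λ (i , j) → f (index A i , index B j))

  infixr 7 _∥_
  _∥_ : ∀ {X₁ X₂ Y₁ Y₂} → Channel X₁ Y₁ → Channel X₂ Y₂ →
        Channel (X₁ ⊗ X₂) (Y₁ ⊗ Y₂)
  _∥_ {X₁} {X₂} {Y₁} {Y₂} C₁ C₂ = record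
    { entry  = p
    ; nonneg = λ (x₁ , x₂) (y₁ , y₂) →
                 *-nonneg (Channel.nonneg C₁ x₁ y₁) (Channel.nonneg C₂ x₂ y₂)
    ; total  = p-total
    }
    where
    p : Elem (X₁ ⊗ X₂) → Elem (Y₁ ⊗ Y₂) → ℝ
    p (x₁ , x₂) (y₁ , y₂) = entry C₁ x₁ y₁ * entry C₂ x₂ y₂

    p-total : ∀ x → ∑[ y ∈ Y₁ ⊗ Y₂ ] p x y ≈ 1#
    p-total (x₁ , x₂) = begin
      ∑ (Y₁ ⊗ Y₂) (p (x₁ , x₂))
        ≈⟨ ∑-⊗ Y₁ Y₂ (p (x₁ , x₂)) ⟩
      ∑[ y₁ ∈ Y₁ ] ∑[ y₂ ∈ Y₂ ] entry C₁ x₁ y₁ * entry C₂ x₂ y₂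
        ≈⟨ ∑-cong Y₁ _ (entry C₁ x₁) (λ y₁ → begin
             ∑[ y₂ ∈ Y₂ ] entry C₁ x₁ y₁ * entry C₂ x₂ y₂
               ≈⟨ ∑-*ˡ Y₂ (entry C₁ x₁ y₁) (entry C₂ x₂) ⟩
             entry C₁ x₁ y₁ * ∑ Y₂ (entry C₂ x₂)
               ≈⟨ *-congˡ (Channel.total C₂ x₂) ⟩
             entry C₁ x₁ y₁ * 1#
               ≈⟨ *-identityʳ (entry C₁ x₁ y₁) ⟩
             entry C₁ x₁ y₁ ∎) ⟩
      ∑ Y₁ (entry C₁ x₁)
        ≈⟨ Channel.total C₁ x₁ ⟩
      1# ∎

  marginal₁ : ∀ X₁ X₂ → Prior (X₁ ⊗ X₂) → Prior X₁
  marginal₁ X₁ X₂ π = record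
    { prob   = λ x₁ → ∑[ x₂ ∈ X₂ ] prob π (x₁ , x₂)
    ; nonneg = λ x₁ → ∑-nonneg X₂ (λ x₂ → Prior.nonneg π (x₁ , x₂))
    ; total  = ≈-trans (≈-sym (∑-⊗ X₁ X₂ (prob π))) (Prior.total π)
    }

  marginal₂ : ∀ X₁ X₂ → Prior (X₁ ⊗ X₂) → Prior X₂
  marginal₂ X₁ X₂ π = record
    { prob   = λ x₂ → ∑[ x₁ ∈ X₁ ] prob π (x₁ , x₂)
    ; nonneg = λ x₂ → ∑-nonneg X₁ (λ x₁ → Prior.nonneg π (x₁ , x₂))
    ; total  = ≈-trans (∑-swap X₂ X₁ (λ x₂ x₁ → prob π (x₁ , x₂)))
                 (≈-trans (≈-sym (∑-⊗ X₁ X₂ (prob π))) (Prior.total π))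
    }

  JointGain : ∀ {W₁ W₂ X₁ X₂} → GainFunction W₁ X₁ → GainFunction W₂ X₂ →
              GainFunction (W₁ ⊗ W₂) (X₁ ⊗ X₂) → Set ℓ
  JointGain g₁ g₂ g = ∀ w₁ w₂ x₁ x₂ →
    gain g (w₁ , w₂) (x₁ , x₂) ≈ 0# ⇔ gain g₁ w₁ x₁ * gain g₂ w₂ x₂ ≈ 0#

  JointlySupported : ∀ X₁ X₂ → Prior (X₁ ⊗ X₂) → Set ℓ
  JointlySupported X₁ X₂ π = ∀ x₁ x₂ →
    ¬ prob (marginal₁ X₁ X₂ π) x₁ * prob (marginal₂ X₁ X₂ π) x₂ ≈ 0# →
    ¬ prob π (x₁ , x₂) ≈ 0#

  module _ {W₁ W₂ X₁ X₂}
           (g₁ : GainFunction W₁ X₁) (g₂ : GainFunction W₂ X₂)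
           (g : GainFunction (W₁ ⊗ W₂) (X₁ ⊗ X₂)) (π : Prior (X₁ ⊗ X₂)) where

    -- All pairs (w , x) with x ∈ 𝒮_w.
    support : List (Elem (W₁ ⊗ W₂) × Elem (X₁ ⊗ X₂))
    support = filter (λ (w , x) → ¬? (prob π x * gain g w x ≟ 0#))
                (cartesianProduct (elements (W₁ ⊗ W₂)) (elements (X₁ ⊗ X₂)))

    ratio : Elem (W₁ ⊗ W₂) × Elem (X₁ ⊗ X₂) → ℝ
    ratio ((w₁ , w₂) , (x₁ , x₂)) =
      (prob (marginal₁ X₁ X₂ π) x₁ * gain g₁ w₁ x₁ *
        (prob (marginal₂ X₁ X₂ π) x₂ * gain g₂ w₂ x₂))
      ÷ (prob π (x₁ , x₂) * gain g (w₁ , w₂) (x₁ , x₂))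

    -- Meaningful when support is nonempty, as it is when 0# < V g π.
    M-min M-max : ℝ
    M-min = minimum (map ratio support)
    M-max = maximum (map ratio support)

{-# OPTIONS --safe #-}
module Submission where

-- Since the logarithm turns products into sums, the two bounds amount to
-- V · M-min ≤ V₁ · V₂ and V₁ · V₂ ≤ V · M-max for the posterior vulnerabilities.  Both hold term
-- by term: M-min and M-max bound the ratio of π₁ g₁ π₂ g₂ to π g where the latter is nonzero.  Where
-- it vanishes, the first bound is trivial, and in the second the left side vanishes too, as π is
-- jointly supported.
--
-- For log₂, approximation by fractions from below gives log₂ x + log₂ y ≤ log₂ (x y); the
-- opposite inequality follows once log₂ x + log₂ x⁻¹ ≥ 0.

open import Defs
open import Algebra.Bundles using (CommutativeRing; Semiring)
open import Data.Empty using (⊥-elim)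
open import Data.Fin.Base using (Fin; zero; suc)
open import Data.List.Base using ([]; _∷_; map; cartesianProduct)
open import Data.List.Membership.Propositional using (_∈_)
open import Data.List.Membership.Propositional.Properties
  using (∈-tabulate⁺; ∈-map⁺; ∈-map⁻; ∈-filter⁺; ∈-filter⁻; ∈-cartesianProduct⁺)
import Data.List.Relation.Unary.All as All
open import Data.List.Relation.Unary.Any using (here; there)
import Data.Nat.Base as ℕ
import Data.Nat.Properties as ℕₚ
open ℕ using (ℕ; zero; suc)
open import Data.Product.Base using (∃; ∃-syntax; _×_; _,_; proj₁; proj₂)
open import Data.Sum.Base using (_⊎_; inj₁; inj₂)
open import Function.Base using (_∘_)
open import Function.Bundles using (Inverse; Equivalence)
open import Relation.Binary.Bundles using (DecTotalOrder)
import Relation.Binary.PropositionalEquality as ≡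
open ≡ using (_≡_)
open import Relation.Nullary using (¬_; Dec; yes; no)
open import Relation.Nullary.Decidable using (¬?)

module _ {c ℓ} (R : Reals c ℓ) where

  open Leakage R
  open CommutativeRing ring
    using (commutativeSemiring; semiring; _-_; +-cong; +-congˡ;
           +-congʳ; +-comm; +-assoc; +-identityˡ; +-identityʳ; -‿inverseˡ; -‿inverseʳ; -‿cong;
           *-cong; *-congˡ; *-congʳ; *-comm; *-assoc; *-identityˡ; *-identityʳ; zeroˡ; zeroʳ;
           distribˡ; distribʳ)
    renaming (refl to ≈-refl; sym to ≈-sym; trans to ≈-trans; reflexive to ≡⇒≈)
  open import Algebra.Definitions.RawSemiring (Semiring.rawSemiring semiring)
    using (sum; _^_) renaming (_×_ to _·_)
  open import Algebra.Properties.Ring (CommutativeRing.ring ring)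
    using (-‿distribˡ-*; -‿distribʳ-*; -‿involutive; -0#≈0#; -‿+-comm)
  open import Algebra.Properties.Semiring.Mult semiring
    using (×-homo-+; ×1-homo-*; ×-assoc-*; ×-congʳ)
  open import Algebra.Properties.Semiring.Exp semiring
    using (^-congˡ; ^-homo-*; ^-assocʳ)
  open import Algebra.Properties.CommutativeSemiring.Exp commutativeSemiring
    using (^-distrib-*)
  open import Algebra.Solver.Ring.NaturalCoefficients.Default commutativeSemiring
    using (solve; _:=_; _:+_; _:*_)

  decTotalOrder : DecTotalOrder c ℓ ℓ
  decTotalOrder = record { isDecTotalOrder = isDecTotalOrder }

  open DecTotalOrder decTotalOrder
    using (poset; _≟_; _≤?_; total; antisym)
    renaming (refl to ≤-refl; trans to ≤-trans; reflexive to ≈⇒≤)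
  open import Data.List.Extrema totalOrder using (argmin-sel; argmax-sel; min≤⊤; min≤xs; ⊥≤max; xs≤max)
  open import Relation.Binary.Reasoning.PartialOrder poset

  -- Arithmetic and order in an ordered field.

  *-interchange : ∀ w x y z → w * x * (y * z) ≈ w * y * (x * z)
  *-interchange = solve 4 (λ w x y z → w :* x :* (y :* z) := w :* y :* (x :* z)) ≈-refl

  +-mono-≤ : ∀ {w x y z} → w ≤ x → y ≤ z → w + y ≤ x + z
  +-mono-≤ {w} {x} {y} {z} w≤x y≤z = begin
    w + y ≤⟨ +-monoʳ-≤ w y≤z ⟩
    w + z ≈⟨ +-comm w z ⟩
    z + w ≤⟨ +-monoʳ-≤ z w≤x ⟩
    z + x ≈⟨ +-comm z x ⟩
    x + z ∎

  -x+[x+y]≈y : ∀ x y → - x + (x + y) ≈ y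
  -x+[x+y]≈y x y = begin-equality
    - x + (x + y) ≈⟨ +-assoc (- x) x y ⟨
    - x + x + y   ≈⟨ +-congʳ (-‿inverseˡ x) ⟩
    0# + y        ≈⟨ +-identityˡ y ⟩
    y             ∎

  x+[-x+y]≈y : ∀ x y → x + (- x + y) ≈ y
  x+[-x+y]≈y x y = begin-equality
    x + (- x + y) ≈⟨ +-assoc x (- x) y ⟨
    x + - x + y   ≈⟨ +-congʳ (-‿inverseʳ x) ⟩
    0# + y        ≈⟨ +-identityˡ y ⟩
    y             ∎

  +-cancelˡ-≤ : ∀ x {y z} → x + y ≤ x + z → y ≤ z
  +-cancelˡ-≤ x {y} {z} x+y≤x+z = begin
    y             ≈⟨ -x+[x+y]≈y x y ⟨
    - x + (x + y) ≤⟨ +-monoʳ-≤ (- x) x+y≤x+z ⟩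
    - x + (x + z) ≈⟨ -x+[x+y]≈y x z ⟩
    z             ∎

  x+y≤z⇒y≤-x+z : ∀ {x y z} → x + y ≤ z → y ≤ - x + z
  x+y≤z⇒y≤-x+z {x} {y} {z} x+y≤z = begin
    y             ≈⟨ -x+[x+y]≈y x y ⟨
    - x + (x + y) ≤⟨ +-monoʳ-≤ (- x) x+y≤z ⟩
    - x + z       ∎

  y≤-x+z⇒x+y≤z : ∀ {x y z} → y ≤ - x + z → x + y ≤ z
  y≤-x+z⇒x+y≤z {x} {y} {z} y≤-x+z = begin
    x + y         ≤⟨ +-monoʳ-≤ x y≤-x+z ⟩
    x + (- x + z) ≈⟨ x+[-x+y]≈y x z ⟩
    z             ∎

  x≤0⇒0≤-x : ∀ {x} → x ≤ 0# → 0# ≤ - x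
  x≤0⇒0≤-x {x} x≤0 = begin
    0#       ≤⟨ x+y≤z⇒y≤-x+z (≤-trans (≈⇒≤ (+-identityʳ x)) x≤0) ⟩
    - x + 0# ≈⟨ +-identityʳ (- x) ⟩
    - x      ∎

  -- The order axiom on products speaks of nonnegative factors; it is applied to `x` and the
  -- difference `- y + z`.
  *-monoˡ-≤ : ∀ {x y z} → 0# ≤ x → y ≤ z → x * y ≤ x * z
  *-monoˡ-≤ {x} {y} {z} 0≤x y≤z = begin
    x * y                   ≈⟨ +-identityʳ (x * y) ⟨
    x * y + 0#              ≤⟨ +-monoʳ-≤ (x * y) (*-nonneg 0≤x 0≤-y+z) ⟩
    x * y + x * (- y + z)   ≈⟨ distribˡ x y (- y + z) ⟨
    x * (y + (- y + z))     ≈⟨ *-congˡ (x+[-x+y]≈y y z) ⟩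
    x * z                   ∎
    where
    0≤-y+z : 0# ≤ - y + z
    0≤-y+z = x+y≤z⇒y≤-x+z (≤-trans (≈⇒≤ (+-identityʳ y)) y≤z)

  *-mono-≤ : ∀ {w x y z} → 0# ≤ w → 0# ≤ z → w ≤ x → y ≤ z → w * y ≤ x * z
  *-mono-≤ {w} {x} {y} {z} 0≤w 0≤z w≤x y≤z = begin
    w * y ≤⟨ *-monoˡ-≤ 0≤w y≤z ⟩
    w * z ≈⟨ *-comm w z ⟩
    z * w ≤⟨ *-monoˡ-≤ 0≤z w≤x ⟩
    z * x ≈⟨ *-comm z x ⟩
    x * z ∎

  -- If 1 were at most 0, then -1 would be nonnegative, and so would its square, which is 1.
  0≤1 : 0# ≤ 1#
  0≤1 with total 0# 1#
  ... | inj₁ 0≤1 = 0≤1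
  ... | inj₂ 1≤0 = begin
    0#              ≤⟨ *-nonneg (x≤0⇒0≤-x 1≤0) (x≤0⇒0≤-x 1≤0) ⟩
    - 1# * - 1#     ≈⟨ -‿distribˡ-* 1# (- 1#) ⟨
    - (1# * - 1#)   ≈⟨ -‿cong (*-identityˡ (- 1#)) ⟩
    - (- 1#)        ≈⟨ -‿involutive 1# ⟩
    1#              ∎

  2# : ℝ
  2# = 1# + 1#

  1≤2 : 1# ≤ 2#
  1≤2 = ≤-trans (≈⇒≤ (≈-sym (+-identityʳ 1#))) (+-monoʳ-≤ 1# 0≤1)

  0≤2 : 0# ≤ 2#
  0≤2 = ≤-trans 0≤1 1≤2

  1≰0 : ¬ 1# ≤ 0#
  1≰0 1≤0 = 1≉0 (antisym 1≤0 0≤1)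

  0<1 : 0# < 1#
  0<1 = 0≤1 , 1≉0 ∘ ≈-sym

  <⇒≉0 : ∀ {x} → 0# < x → ¬ x ≈ 0#
  <⇒≉0 (_ , 0≉x) = 0≉x ∘ ≈-sym

  <-≤-trans : ∀ {x y} → 0# < x → x ≤ y → 0# < y
  <-≤-trans (0≤x , 0≉x) x≤y =
    ≤-trans 0≤x x≤y , λ 0≈y → 0≉x (antisym 0≤x (≤-trans x≤y (≈⇒≤ (≈-sym 0≈y))))

  ≉0⇒> : ∀ {x} → 0# ≤ x → ¬ x ≈ 0# → 0# < x
  ≉0⇒> 0≤x x≉0 = 0≤x , x≉0 ∘ ≈-sym

  x*y≈1⇒x≉0 : ∀ {x y} → x * y ≈ 1# → ¬ x ≈ 0#
  x*y≈1⇒x≉0 {x} {y} xy≈1 x≈0 = 1≉0 (begin-equality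
    1#     ≈⟨ xy≈1 ⟨
    x * y  ≈⟨ *-congʳ x≈0 ⟩
    0# * y ≈⟨ zeroˡ y ⟩
    0#     ∎)

  ⁻¹-inverseˡ : ∀ x → ¬ x ≈ 0# → x ⁻¹ * x ≈ 1#
  ⁻¹-inverseˡ x x≉0 = ≈-trans (*-comm (x ⁻¹) x) (⁻¹-inverseʳ x x≉0)

  x⁻¹*[x*y]≈y : ∀ x y → ¬ x ≈ 0# → x ⁻¹ * (x * y) ≈ y
  x⁻¹*[x*y]≈y x y x≉0 = begin-equality
    x ⁻¹ * (x * y) ≈⟨ *-assoc (x ⁻¹) x y ⟨
    x ⁻¹ * x * y   ≈⟨ *-congʳ (⁻¹-inverseˡ x x≉0) ⟩
    1# * y         ≈⟨ *-identityˡ y ⟩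
    y              ∎

  x*[y÷x]≈y : ∀ x y → ¬ x ≈ 0# → x * (y ÷ x) ≈ y
  x*[y÷x]≈y x y x≉0 = begin-equality
    x * (y * x ⁻¹) ≈⟨ *-comm x (y * x ⁻¹) ⟩
    y * x ⁻¹ * x   ≈⟨ *-assoc y (x ⁻¹) x ⟩
    y * (x ⁻¹ * x) ≈⟨ *-congˡ (⁻¹-inverseˡ x x≉0) ⟩
    y * 1#         ≈⟨ *-identityʳ y ⟩
    y              ∎

  *-≉0 : ∀ {x y} → ¬ x ≈ 0# → ¬ y ≈ 0# → ¬ x * y ≈ 0#
  *-≉0 {x} {y} x≉0 y≉0 xy≈0 = y≉0 (begin-equality
    y              ≈⟨ x⁻¹*[x*y]≈y x y x≉0 ⟨
    x ⁻¹ * (x * y) ≈⟨ *-congˡ xy≈0 ⟩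
    x ⁻¹ * 0#      ≈⟨ zeroʳ (x ⁻¹) ⟩
    0#             ∎)

  *≉0⇒≉0ˡ : ∀ {x y} → ¬ x * y ≈ 0# → ¬ x ≈ 0#
  *≉0⇒≉0ˡ {x} {y} xy≉0 x≈0 = xy≉0 (≈-trans (*-congʳ x≈0) (zeroˡ y))

  *≉0⇒≉0ʳ : ∀ {x y} → ¬ x * y ≈ 0# → ¬ y ≈ 0#
  *≉0⇒≉0ʳ {x} {y} xy≉0 y≈0 = xy≉0 (≈-trans (*-congˡ y≈0) (zeroʳ x))

  *-pos : ∀ {x y} → 0# < x → 0# < y → 0# < x * y
  *-pos 0<x 0<y = ≉0⇒> (*-nonneg (proj₁ 0<x) (proj₁ 0<y)) (*-≉0 (<⇒≉0 0<x) (<⇒≉0 0<y))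

  ⁻¹-pos : ∀ {x} → 0# < x → 0# < x ⁻¹
  ⁻¹-pos {x} 0<x = ≉0⇒> 0≤x⁻¹ (x*y≈1⇒x≉0 (⁻¹-inverseˡ x (<⇒≉0 0<x)))
    where
    0≤x⁻¹ : 0# ≤ x ⁻¹
    0≤x⁻¹ with total 0# (x ⁻¹)
    ... | inj₁ 0≤x⁻¹ = 0≤x⁻¹
    -- A nonpositive inverse would make the product `x * x ⁻¹`, which is 1, nonpositive.
    ... | inj₂ x⁻¹≤0 = ⊥-elim (1≰0 (begin
      1#       ≈⟨ ⁻¹-inverseʳ x (<⇒≉0 0<x) ⟨
      x * x ⁻¹ ≤⟨ *-monoˡ-≤ (proj₁ 0<x) x⁻¹≤0 ⟩
      x * 0#   ≈⟨ zeroʳ x ⟩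
      0#       ∎))

  *-cancelˡ-≤ : ∀ {x y z} → 0# < x → x * y ≤ x * z → y ≤ z
  *-cancelˡ-≤ {x} {y} {z} 0<x xy≤xz = begin
    y              ≈⟨ x⁻¹*[x*y]≈y x y (<⇒≉0 0<x) ⟨
    x ⁻¹ * (x * y) ≤⟨ *-monoˡ-≤ (proj₁ (⁻¹-pos 0<x)) xy≤xz ⟩
    x ⁻¹ * (x * z) ≈⟨ x⁻¹*[x*y]≈y x z (<⇒≉0 0<x) ⟩
    z              ∎

  -- Natural numbers, powers of two and the Archimedean property.

  ι : ℕ → ℝ
  ι n = n · 1#

  ·≈ι* : ∀ n x → n · x ≈ ι n * x
  ·≈ι* n x = begin-equality
    n · x        ≈⟨ ×-congʳ n (*-identityˡ x) ⟨
    n · (1# * x) ≈⟨ ×-assoc-* n 1# x ⟨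
    ι n * x      ∎

  ι-nonneg : ∀ n → 0# ≤ ι n
  ι-nonneg zero    = ≤-refl
  ι-nonneg (suc n) = +-nonneg 0≤1 (ι-nonneg n)

  ι-suc-pos : ∀ n → 0# < ι (suc n)
  ι-suc-pos n = <-≤-trans 0<1 (≤-trans (≈⇒≤ (≈-sym (+-identityʳ 1#))) (+-monoʳ-≤ 1# (ι-nonneg n)))

  ^-pos : ∀ {x} n → 0# < x → 0# < x ^ n
  ^-pos zero    0<x = 0<1
  ^-pos (suc n) 0<x = *-pos 0<x (^-pos n 0<x)

  ^-mono-≤ : ∀ {x y} n → 0# < x → x ≤ y → x ^ n ≤ y ^ n
  ^-mono-≤ zero    0<x x≤y = ≤-refl
  ^-mono-≤ (suc n) 0<x x≤y =
    *-mono-≤ (proj₁ 0<x) (proj₁ (^-pos n (<-≤-trans 0<x x≤y))) x≤y (^-mono-≤ n 0<x x≤y)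

  1^n≈1 : ∀ n → 1# ^ n ≈ 1#
  1^n≈1 zero    = ≈-refl
  1^n≈1 (suc n) = ≈-trans (*-identityˡ (1# ^ n)) (1^n≈1 n)

  0<2 : 0# < 2#
  0<2 = <-≤-trans 0<1 1≤2

  1≤2^n : ∀ n → 1# ≤ 2# ^ n
  1≤2^n n = ≤-trans (≈⇒≤ (≈-sym (1^n≈1 n))) (^-mono-≤ n 0<1 1≤2)

  2^[1+n]≰1 : ∀ n → ¬ 2# ^ suc n ≤ 1#
  2^[1+n]≰1 n 2^[1+n]≤1 = 1≰0 (+-cancelˡ-≤ 1# (begin
    2#              ≈⟨ *-identityʳ 2# ⟨
    2# * 1#         ≤⟨ *-monoˡ-≤ 0≤2 (1≤2^n n) ⟩
    2# ^ suc n      ≤⟨ 2^[1+n]≤1 ⟩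
    1#              ≈⟨ +-identityʳ 1# ⟨
    1# + 0#         ∎))

  -- One factor of 2 is cancelled at a time. This turns the inequality in `BelowLog₂`, which is
  -- about powers, into one about exponents.
  2^-cancel-≤ : ∀ a b → 2# ^ a ≤ 2# ^ b → ι a ≤ ι b
  2^-cancel-≤ zero    b       _  = ι-nonneg b
  2^-cancel-≤ (suc a) zero    le = ⊥-elim (2^[1+n]≰1 a le)
  2^-cancel-≤ (suc a) (suc b) le = +-monoʳ-≤ 1# (2^-cancel-≤ a b (*-cancelˡ-≤ 0<2 le))

  -- Carries unboundedness over from the naturals to the powers of two, whose exponents serve as
  -- crude bounds for logarithms.
  ι≤2^ : ∀ n → ι n ≤ 2# ^ n
  ι≤2^ zero    = 0≤1
  ι≤2^ (suc n) = begin
    1# + ι n                ≤⟨ +-mono-≤ (1≤2^n n) (ι≤2^ n) ⟩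
    2# ^ n + 2# ^ n         ≈⟨ +-cong (*-identityˡ _) (*-identityˡ _) ⟨
    1# * 2# ^ n + 1# * 2# ^ n ≈⟨ distribʳ (2# ^ n) 1# 1# ⟨
    2# ^ suc n              ∎

  -- Otherwise the set of naturals would have a supremum s, and s − 1 would bound it too.
  ℕ-unbounded : ∀ x → ¬ (∀ n → ι n ≤ x)
  ℕ-unbounded x ι≤x = 1≰0 (+-cancelˡ-≤ s (begin
    s + 1#          ≤⟨ +-mono-≤ s≤-1+s ≤-refl ⟩
    - 1# + s + 1#   ≈⟨ +-comm _ 1# ⟩
    1# + (- 1# + s) ≈⟨ x+[-x+y]≈y 1# s ⟩
    s               ≈⟨ +-identityʳ s ⟨
    s + 0#          ∎))
    where
    IsNatural : ℝ → Set ℓ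
    IsNatural r = ∃[ n ] ι n ≈ r

    s : ℝ
    s = sup IsNatural

    inhabited : ∃ IsNatural
    inhabited = 0# , 0 , ≈-refl

    ι≤s : ∀ n → ι n ≤ s
    ι≤s n = sup-upper IsNatural inhabited
      (x , λ { _ (m , ιm≈r) → ≤-trans (≈⇒≤ (≈-sym ιm≈r)) (ι≤x m) }) (ι n) (n , ≈-refl)

    s≤-1+s : s ≤ - 1# + s
    s≤-1+s = sup-least IsNatural inhabited (- 1# + s)
      λ { r (n , ιn≈r) → ≤-trans (≈⇒≤ (≈-sym ιn≈r)) (x+y≤z⇒y≤-x+z (ι≤s (suc n))) }

  -- The n cannot be computed from x; but inequalities are decidable, hence stable under
  -- double negation, so in proving one we may assume that an n is given.
  archimedean : ∀ x {y z} → (∀ n → x ≤ ι n → y ≤ z) → y ≤ z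
  archimedean x {y} {z} k with y ≤? z
  ... | yes y≤z = y≤z
  ... | no  y≰z = ⊥-elim (ℕ-unbounded x λ n → below n (total (ι n) x))
    where
    below : ∀ n → ι n ≤ x ⊎ x ≤ ι n → ι n ≤ x
    below n (inj₁ ιn≤x) = ιn≤x
    below n (inj₂ x≤ιn) = ⊥-elim (y≰z (k n x≤ιn))

  archimedean-2^ : ∀ x {y z} → (∀ n → x ≤ 2# ^ n → y ≤ z) → y ≤ z
  archimedean-2^ x k = archimedean x λ n x≤ιn → k n (≤-trans x≤ιn (ι≤2^ n))

  -- The search descends from `m` and stops at the first power of two that is not above `x`; since
  -- `1# ≤ x`, it stops at exponent 0 at the latest.
  2^-bracket : ∀ {x} m → 1# ≤ x → x ≤ 2# ^ m → ∃[ k ] 2# ^ k ≤ x × x ≤ 2# ^ suc k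
  2^-bracket zero    1≤x x≤1 = 0 , 1≤x , ≤-trans x≤1 (1≤2^n 1)
  2^-bracket {x} (suc m) 1≤x x≤2^[1+m] with total (2# ^ m) x
  ... | inj₁ 2^m≤x = m , 2^m≤x , x≤2^[1+m]
  ... | inj₂ x≤2^m = 2^-bracket m 1≤x x≤2^m

  -- The binary logarithm.

  -- The only `t` that the equation in `BelowLog₂` allows for `a`, `b` and `n`. A difference of
  -- naturals as numerator covers both signs.
  fraction : ℕ → ℕ → ℕ → ℝ
  fraction a b n = (ι a - ι b) ÷ ι (suc n)

  fraction-BelowLog₂ : ∀ {x} a b n → 2# ^ a ≤ 2# ^ b * x ^ suc n → BelowLog₂ x (fraction a b n)
  fraction-BelowLog₂ a b n le = a , b , n , eq , le
    where
    eq : suc n · fraction a b n + ι b ≈ ι a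
    eq = begin-equality
      suc n · fraction a b n + ι b    ≈⟨ +-congʳ (·≈ι* (suc n) (fraction a b n)) ⟩
      ι (suc n) * fraction a b n + ι b ≈⟨ +-congʳ (x*[y÷x]≈y _ _ (<⇒≉0 (ι-suc-pos n))) ⟩
      ι a - ι b + ι b                 ≈⟨ +-assoc _ _ _ ⟩
      ι a + (- ι b + ι b)             ≈⟨ +-congˡ (-‿inverseˡ (ι b)) ⟩
      ι a + 0#                        ≈⟨ +-identityʳ (ι a) ⟩
      ι a                             ∎

  -- Replacing `x` by `2# ^ k` leaves powers of two on both sides. Comparing exponents gives a ≤ b +
  -- k (1 + n), and division by 1 + n gives t ≤ k.
  BelowLog₂-bounded : ∀ {x} k → 0# < x → x ≤ 2# ^ k → UpperBound (BelowLog₂ x) (ι k)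
  BelowLog₂-bounded {x} k 0<x x≤2^k t (a , b , n , eq , le) =
    *-cancelˡ-≤ (ι-suc-pos n) (+-cancelˡ-≤ (ι b) (begin
      ι b + ι (suc n) * t        ≈⟨ +-comm (ι b) _ ⟩
      ι (suc n) * t + ι b        ≈⟨ +-congʳ (·≈ι* (suc n) t) ⟨
      suc n · t + ι b            ≈⟨ eq ⟩
      ι a                        ≤⟨ 2^-cancel-≤ a (b ℕ.+ k ℕ.* suc n) 2^a≤ ⟩
      ι (b ℕ.+ k ℕ.* suc n)      ≈⟨ ×-homo-+ 1# b (k ℕ.* suc n) ⟩
      ι b + ι (k ℕ.* suc n)      ≈⟨ +-congˡ (×1-homo-* k (suc n)) ⟩
      ι b + ι k * ι (suc n)      ≈⟨ +-congˡ (*-comm (ι k) _) ⟩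
      ι b + ι (suc n) * ι k      ∎))
    where
    2^a≤ : 2# ^ a ≤ 2# ^ (b ℕ.+ k ℕ.* suc n)
    2^a≤ = begin
      2# ^ a                       ≤⟨ le ⟩
      2# ^ b * x ^ suc n           ≤⟨ *-monoˡ-≤ (proj₁ (^-pos b 0<2)) (^-mono-≤ (suc n) 0<x x≤2^k) ⟩
      2# ^ b * (2# ^ k) ^ suc n    ≈⟨ *-congˡ (^-assocʳ 2# k (suc n)) ⟩
      2# ^ b * 2# ^ (k ℕ.* suc n)  ≈⟨ ^-homo-* 2# b (k ℕ.* suc n) ⟨
      2# ^ (b ℕ.+ k ℕ.* suc n)     ∎

  -- `sup-upper` asks for some upper bound of the set. An exponent `k` with `x ≤ 2# ^ k` provides
  -- one, and it may be assumed because the goal is an inequality.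
  log₂-upper : ∀ {x t} → 0# < x → BelowLog₂ x t → t ≤ log₂ x
  log₂-upper {x} {t} 0<x below = archimedean-2^ x λ k x≤2^k →
    sup-upper (BelowLog₂ x) (t , below) (ι k , BelowLog₂-bounded k 0<x x≤2^k) t below

  log₂-least : ∀ {x u} → 0# < x → UpperBound (BelowLog₂ x) u → log₂ x ≤ u
  log₂-least {x} {u} 0<x bound = archimedean-2^ (x ⁻¹) λ b x⁻¹≤2^b →
    sup-least (BelowLog₂ x)
      -- `sup-least` asks for a member of the set. This fraction is -b, which qualifies because
      -- `x ⁻¹ ≤ 2# ^ b`.
      (fraction 0 b 0 , fraction-BelowLog₂ 0 b 0 (begin
        1#              ≈⟨ ⁻¹-inverseˡ x (<⇒≉0 0<x) ⟨
        x ⁻¹ * x        ≤⟨ *-mono-≤ (proj₁ (⁻¹-pos 0<x)) (proj₁ 0<x) x⁻¹≤2^b ≤-refl ⟩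
        2# ^ b * x      ≈⟨ *-congˡ (*-identityʳ x) ⟨
        2# ^ b * x ^ 1  ∎))
      u bound

  -- The fractions are brought to the common denominator `N ℕ.* N′`: the first inequality is raised
  -- to the power `N′`, the second to the power `N`, and the two are multiplied. Letting `z` exceed
  -- `x * y` includes monotonicity.
  BelowLog₂-+ : ∀ {x y z s t} → 0# < x → 0# < y → x * y ≤ z →
                BelowLog₂ x s → BelowLog₂ y t → BelowLog₂ z (s + t)
  BelowLog₂-+ {x} {y} {z} {s} {t} 0<x 0<y xy≤z (a , b , n , eq , le) (a′ , b′ , n′ , eq′ , le′) =
    -- `BelowLog₂` stores the denominator minus one, and `N ℕ.* N′` reduces to
    -- `suc (n′ ℕ.+ n ℕ.* N′)`.
    a ℕ.* N′ ℕ.+ a′ ℕ.* N , b ℕ.* N′ ℕ.+ b′ ℕ.* N , n′ ℕ.+ n ℕ.* N′ , sum-eq , sum-le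
    where
    N N′ : ℕ
    N  = suc n
    N′ = suc n′

    ι-lin : ∀ i j → ι (i ℕ.* N′ ℕ.+ j ℕ.* N) ≈ ι i * ι N′ + ι j * ι N
    ι-lin i j = ≈-trans (×-homo-+ 1# (i ℕ.* N′) (j ℕ.* N)) (+-cong (×1-homo-* i N′) (×1-homo-* j N))

    sum-eq : (N ℕ.* N′) · (s + t) + ι (b ℕ.* N′ ℕ.+ b′ ℕ.* N) ≈ ι (a ℕ.* N′ ℕ.+ a′ ℕ.* N)
    sum-eq = begin-equality
      (N ℕ.* N′) · (s + t) + ι (b ℕ.* N′ ℕ.+ b′ ℕ.* N)
        ≈⟨ +-cong (≈-trans (·≈ι* (N ℕ.* N′) (s + t)) (*-congʳ (×1-homo-* N N′))) (ι-lin b b′) ⟩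
      ι N * ι N′ * (s + t) + (ι b * ι N′ + ι b′ * ι N)
        ≈⟨ solve 6 (λ p q s t b b′ → p :* q :* (s :+ t) :+ (b :* q :+ b′ :* p)
             := (p :* s :+ b) :* q :+ (q :* t :+ b′) :* p) ≈-refl (ι N) (ι N′) s t (ι b) (ι b′) ⟩
      (ι N * s + ι b) * ι N′ + (ι N′ * t + ι b′) * ι N
        ≈⟨ +-cong (*-congʳ (+-congʳ (·≈ι* N s))) (*-congʳ (+-congʳ (·≈ι* N′ t))) ⟨
      (N · s + ι b) * ι N′ + (N′ · t + ι b′) * ι N
        ≈⟨ +-cong (*-congʳ eq) (*-congʳ eq′) ⟩
      ι a * ι N′ + ι a′ * ι N
        ≈⟨ ι-lin a a′ ⟨
      ι (a ℕ.* N′ ℕ.+ a′ ℕ.* N) ∎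

    2^-lin : ∀ i j → 2# ^ (i ℕ.* N′ ℕ.+ j ℕ.* N) ≈ (2# ^ i) ^ N′ * (2# ^ j) ^ N
    2^-lin i j = ≈-trans (^-homo-* 2# (i ℕ.* N′) (j ℕ.* N))
      (≈-sym (*-cong (^-assocʳ 2# i N′) (^-assocʳ 2# j N)))

    pow-pos : ∀ m {w} k → 0# < w → 0# < 2# ^ m * w ^ k
    pow-pos m k 0<w = *-pos (^-pos m 0<2) (^-pos k 0<w)

    powers : (x ^ N) ^ N′ * (y ^ N′) ^ N ≈ (x * y) ^ (N ℕ.* N′)
    powers = begin-equality
      (x ^ N) ^ N′ * (y ^ N′) ^ N
        ≈⟨ *-cong (^-assocʳ x N N′) (^-assocʳ y N′ N) ⟩
      x ^ (N ℕ.* N′) * y ^ (N′ ℕ.* N)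
        ≈⟨ *-congˡ (≡⇒≈ (≡.cong (y ^_) (ℕₚ.*-comm N′ N))) ⟩
      x ^ (N ℕ.* N′) * y ^ (N ℕ.* N′)
        ≈⟨ ^-distrib-* x y (N ℕ.* N′) ⟨
      (x * y) ^ (N ℕ.* N′) ∎

    sum-le : 2# ^ (a ℕ.* N′ ℕ.+ a′ ℕ.* N) ≤ 2# ^ (b ℕ.* N′ ℕ.+ b′ ℕ.* N) * z ^ (N ℕ.* N′)
    sum-le = begin
      2# ^ (a ℕ.* N′ ℕ.+ a′ ℕ.* N)
        ≈⟨ 2^-lin a a′ ⟩
      (2# ^ a) ^ N′ * (2# ^ a′) ^ N
        ≤⟨ *-mono-≤ (proj₁ (^-pos N′ (^-pos a 0<2))) (proj₁ (^-pos N (pow-pos b′ N′ 0<y)))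
             (^-mono-≤ N′ (^-pos a 0<2) le) (^-mono-≤ N (^-pos a′ 0<2) le′) ⟩
      (2# ^ b * x ^ N) ^ N′ * (2# ^ b′ * y ^ N′) ^ N
        ≈⟨ *-cong (^-distrib-* (2# ^ b) (x ^ N) N′) (^-distrib-* (2# ^ b′) (y ^ N′) N) ⟩
      (2# ^ b) ^ N′ * (x ^ N) ^ N′ * ((2# ^ b′) ^ N * (y ^ N′) ^ N)
        ≈⟨ *-interchange _ _ _ _ ⟩
      (2# ^ b) ^ N′ * (2# ^ b′) ^ N * ((x ^ N) ^ N′ * (y ^ N′) ^ N)
        ≈⟨ *-cong (≈-sym (2^-lin b b′)) powers ⟩
      2# ^ (b ℕ.* N′ ℕ.+ b′ ℕ.* N) * (x * y) ^ (N ℕ.* N′)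
        ≤⟨ *-monoˡ-≤ (proj₁ (^-pos (b ℕ.* N′ ℕ.+ b′ ℕ.* N) 0<2))
             (^-mono-≤ (N ℕ.* N′) (*-pos 0<x 0<y) xy≤z) ⟩
      2# ^ (b ℕ.* N′ ℕ.+ b′ ℕ.* N) * z ^ (N ℕ.* N′) ∎

  -- By `BelowLog₂-+`, sums of approximations from below stay below `log₂ z`. The suprema over `t`
  -- and `s` are taken one at a time, with the other summand moved across the inequality.
  log₂-superadditive : ∀ {x y z} → 0# < x → 0# < y → x * y ≤ z → log₂ x + log₂ y ≤ log₂ z
  log₂-superadditive {x} {y} {z} 0<x 0<y xy≤z =
    y≤-x+z⇒x+y≤z (log₂-least 0<y λ t t≤ → x+y≤z⇒y≤-x+z (begin
      log₂ x + t ≈⟨ +-comm (log₂ x) t ⟩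
      t + log₂ x ≤⟨ y≤-x+z⇒x+y≤z (log₂-least 0<x λ s s≤ → x+y≤z⇒y≤-x+z (begin
        t + s  ≈⟨ +-comm t s ⟩
        s + t  ≤⟨ log₂-upper (<-≤-trans (*-pos 0<x 0<y) xy≤z) (BelowLog₂-+ 0<x 0<y xy≤z s≤ t≤) ⟩
        log₂ z ∎)) ⟩
      log₂ z     ∎))

  -- Bracketing x ^ (1 + n) between consecutive powers of two gives fractions with denominator
  -- 1 + n below log₂ x and log₂ x ⁻¹ whose numerators add up to −1.
  log₂-⁻¹-approx : ∀ {x} n → 0# < x → 0# ≤ ι (suc n) * (log₂ x + log₂ (x ⁻¹)) + 1#
  log₂-⁻¹-approx {x} n 0<x =
    -- The factor `2# ^ b` lifts `x ^ N` to at least 1, so that the bracketing exponent is a natural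
    -- number; `m` is where the search for it starts.
    archimedean-2^ ((x ^ N) ⁻¹) λ b lower → archimedean-2^ (2# ^ b * x ^ N) λ m upper →
    bracketed b (2^-bracket m (1≤ b lower) upper)
    where
    N : ℕ
    N = suc n

    0<x^N : 0# < x ^ N
    0<x^N = ^-pos N 0<x

    0<x⁻¹ : 0# < x ⁻¹
    0<x⁻¹ = ⁻¹-pos 0<x

    u v : ℝ
    u = log₂ x
    v = log₂ (x ⁻¹)

    1≤ : ∀ b → (x ^ N) ⁻¹ ≤ 2# ^ b → 1# ≤ 2# ^ b * x ^ N
    1≤ b lower = begin
      1#                  ≈⟨ ⁻¹-inverseˡ (x ^ N) (<⇒≉0 0<x^N) ⟨
      (x ^ N) ⁻¹ * x ^ N  ≤⟨ *-mono-≤ (proj₁ (⁻¹-pos 0<x^N)) (proj₁ 0<x^N) lower ≤-refl ⟩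
      2# ^ b * x ^ N      ∎

    cancel-x^N : ∀ b → 2# ^ b * x ^ N * (x ⁻¹) ^ N ≈ 2# ^ b
    cancel-x^N b = begin-equality
      2# ^ b * x ^ N * (x ⁻¹) ^ N   ≈⟨ *-assoc _ _ _ ⟩
      2# ^ b * (x ^ N * (x ⁻¹) ^ N) ≈⟨ *-congˡ (^-distrib-* x (x ⁻¹) N) ⟨
      2# ^ b * (x * x ⁻¹) ^ N       ≈⟨ *-congˡ (^-congˡ N (⁻¹-inverseʳ x (<⇒≉0 0<x))) ⟩
      2# ^ b * 1# ^ N               ≈⟨ *-congˡ (1^n≈1 N) ⟩
      2# ^ b * 1#                   ≈⟨ *-identityʳ _ ⟩
      2# ^ b                        ∎

    -- `log₂-upper` for the fraction (a - b) / N, with the denominator cleared.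
    scaled : ∀ {w} → 0# < w → ∀ a b → 2# ^ a ≤ 2# ^ b * w ^ N → ι a ≤ ι N * log₂ w + ι b
    scaled {w} 0<w a b le = begin
      -- The projections pick out the equation in `BelowLog₂`.
      ι a                        ≈⟨ proj₁ (proj₂ (proj₂ (proj₂ below))) ⟨
      N · fraction a b n + ι b   ≈⟨ +-congʳ (·≈ι* N _) ⟩
      ι N * fraction a b n + ι b ≤⟨ +-mono-≤ (*-monoˡ-≤ (ι-nonneg N) (log₂-upper 0<w below)) ≤-refl ⟩
      ι N * log₂ w + ι b         ∎
      where
      below : BelowLog₂ w (fraction a b n)
      below = fraction-BelowLog₂ a b n le

    bracketed : ∀ b → ∃[ k ] 2# ^ k ≤ 2# ^ b * x ^ N × 2# ^ b * x ^ N ≤ 2# ^ suc k →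
                0# ≤ ι N * (u + v) + 1#
    -- The two fractions give k - b ≤ N u and b - (1 + k) ≤ N v, which add up to -1 ≤ N (u + v).
    bracketed b (k , 2^k≤ , ≤2^[1+k]) = +-cancelˡ-≤ (ι k + ι b) (begin
      ι k + ι b + 0#                              ≈⟨ +-identityʳ _ ⟩
      ι k + ι b                                   ≤⟨ +-mono-≤ (scaled 0<x k b 2^k≤) (scaled 0<x⁻¹ b (suc k) 2^b≤) ⟩
      ι N * u + ι b + (ι N * v + (1# + ι k))
        ≈⟨ solve 6 (λ p u v b o k → p :* u :+ b :+ (p :* v :+ (o :+ k))
             := k :+ b :+ (p :* (u :+ v) :+ o)) ≈-refl (ι N) u v (ι b) 1# (ι k) ⟩
      ι k + ι b + (ι N * (u + v) + 1#)            ∎)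
      where
      2^b≤ : 2# ^ b ≤ 2# ^ suc k * (x ⁻¹) ^ N
      2^b≤ = begin
        2# ^ b                       ≈⟨ cancel-x^N b ⟨
        2# ^ b * x ^ N * (x ⁻¹) ^ N  ≤⟨ *-mono-≤ (proj₁ (*-pos (^-pos b 0<2) 0<x^N)) (proj₁ (^-pos N 0<x⁻¹))
                                          ≤2^[1+k] ≤-refl ⟩
        2# ^ suc k * (x ⁻¹) ^ N      ∎

  -- If `w` were negative, some n ≥ 1 / (-w) would give n w + 1 ≤ 0, and then 0 ≤ (1 + n) w + 1 ≤ w.
  -ε≤⇒0≤ : ∀ w → (∀ n → 0# ≤ ι (suc n) * w + 1#) → 0# ≤ w
  -ε≤⇒0≤ w approx with 0# ≤? w
  ... | yes 0≤w = 0≤w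
  ... | no  0≰w = archimedean ((- w) ⁻¹) λ n le → begin
    0#                    ≤⟨ approx n ⟩
    (1# + ι n) * w + 1#   ≈⟨ +-congʳ (distribʳ w 1# (ι n)) ⟩
    1# * w + ι n * w + 1# ≈⟨ +-congʳ (+-congʳ (*-identityˡ w)) ⟩
    w + ι n * w + 1#      ≈⟨ +-assoc w (ι n * w) 1# ⟩
    w + (ι n * w + 1#)    ≤⟨ +-monoʳ-≤ w (y≤-x+z⇒x+y≤z (begin
      1#                      ≈⟨ ⁻¹-inverseˡ (- w) (<⇒≉0 0<-w) ⟨
      (- w) ⁻¹ * - w          ≤⟨ *-mono-≤ (proj₁ (⁻¹-pos 0<-w)) (proj₁ 0<-w) le ≤-refl ⟩
      ι n * - w               ≈⟨ -‿distribʳ-* (ι n) w ⟨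
      - (ι n * w)             ≈⟨ +-identityʳ _ ⟨
      - (ι n * w) + 0#        ∎)) ⟩
    w + 0#                ≈⟨ +-identityʳ w ⟩
    w                     ∎
    where
    w≤0 : w ≤ 0#
    w≤0 with total w 0#
    ... | inj₁ w≤0 = w≤0
    ... | inj₂ 0≤w = ⊥-elim (0≰w 0≤w)

    0<-w : 0# < - w
    0<-w = x≤0⇒0≤-x w≤0 , λ 0≈-w → 0≰w (≈⇒≤ (begin-equality
      0#      ≈⟨ -0#≈0# ⟨
      - 0#    ≈⟨ -‿cong 0≈-w ⟩
      - (- w) ≈⟨ -‿involutive w ⟩
      w       ∎))

  -- Superadditivity bounds the left side by `log₂ (w * x)`. Adding the nonnegative
  -- `log₂ y + log₂ (y ⁻¹)` and applying superadditivity again, to `y ⁻¹` and `w * x`, leaves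
  -- `log₂ y + log₂ z`.
  log₂-*-mono-≤ : ∀ {w x y z} → 0# < w → 0# < x → 0# < y → 0# < z →
                  w * x ≤ y * z → log₂ w + log₂ x ≤ log₂ y + log₂ z
  log₂-*-mono-≤ {w} {x} {y} {z} 0<w 0<x 0<y 0<z wx≤yz = begin
    log₂ w + log₂ x
      ≤⟨ log₂-superadditive 0<w 0<x ≤-refl ⟩
    log₂ (w * x)
      ≈⟨ +-identityʳ _ ⟨
    log₂ (w * x) + 0#
      ≤⟨ +-monoʳ-≤ _ (-ε≤⇒0≤ _ λ n → log₂-⁻¹-approx n 0<y) ⟩
    log₂ (w * x) + (log₂ y + log₂ (y ⁻¹))
      ≈⟨ solve 3 (λ p q r → p :+ (q :+ r) := q :+ (r :+ p)) ≈-refl _ _ _ ⟩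
    log₂ y + (log₂ (y ⁻¹) + log₂ (w * x))
      ≤⟨ +-monoʳ-≤ _ (log₂-superadditive (⁻¹-pos 0<y) (*-pos 0<w 0<x) (begin
           y ⁻¹ * (w * x) ≤⟨ *-monoˡ-≤ (proj₁ (⁻¹-pos 0<y)) wx≤yz ⟩
           y ⁻¹ * (y * z) ≈⟨ x⁻¹*[x*y]≈y y z (<⇒≉0 0<y) ⟩
           z              ∎)) ⟩
    log₂ y + log₂ z ∎

  -- Sign changes between logarithms and entropies.

  -x-y+[x+y]≈0 : ∀ x y → - x + - y + (x + y) ≈ 0#
  -x-y+[x+y]≈0 x y = ≈-trans (+-congʳ (-‿+-comm x y)) (-‿inverseˡ (x + y))

  -- Here and in `a+b≤v+m⇒-v≤-a-b+m`, `v`, `a` and `b` stand for the logarithms of the joint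
  -- vulnerability and of the two single ones, and `m` for that of `M-min` or `M-max`.
  v+m≤a+b⇒-a-b+m≤-v : ∀ {a b v m} → v + m ≤ a + b → - a + - b + m ≤ - v
  v+m≤a+b⇒-a-b+m≤-v {a} {b} {v} {m} v+m≤a+b = +-cancelˡ-≤ v (begin
    v + (- a + - b + m)  ≈⟨ solve 3 (λ v s m → v :+ (s :+ m) := s :+ (v :+ m)) ≈-refl v (- a + - b) m ⟩
    - a + - b + (v + m)  ≤⟨ +-monoʳ-≤ _ v+m≤a+b ⟩
    - a + - b + (a + b)  ≈⟨ -x-y+[x+y]≈0 a b ⟩
    0#                   ≈⟨ -‿inverseʳ v ⟨
    v + - v              ∎)

  a+b≤v+m⇒-v≤-a-b+m : ∀ {a b v m} → a + b ≤ v + m → - v ≤ - a + - b + m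
  a+b≤v+m⇒-v≤-a-b+m {a} {b} {v} {m} a+b≤v+m = +-cancelˡ-≤ v (begin
    v + - v              ≈⟨ -‿inverseʳ v ⟩
    0#                   ≈⟨ -x-y+[x+y]≈0 a b ⟨
    - a + - b + (a + b)  ≤⟨ +-monoʳ-≤ _ a+b≤v+m ⟩
    - a + - b + (v + m)  ≈⟨ solve 3 (λ v s m → s :+ (v :+ m) := v :+ (s :+ m)) ≈-refl v (- a + - b) m ⟩
    v + (- a + - b + m)  ∎)

  -- Finite sums and maxima.

  sum-mono-≤ : ∀ {n} {f h : Fin n → ℝ} → (∀ i → f i ≤ h i) → sum f ≤ sum h
  sum-mono-≤ {zero}  f≤h = ≤-refl
  sum-mono-≤ {suc n} f≤h = +-mono-≤ (f≤h zero) (sum-mono-≤ (f≤h ∘ suc))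

  term≤sum : ∀ {n} {f : Fin n → ℝ} → (∀ i → 0# ≤ f i) → ∀ i → f i ≤ sum f
  term≤sum {suc n} {f} 0≤f zero = begin
    f zero                     ≈⟨ +-identityʳ _ ⟨
    f zero + 0#                ≤⟨ +-monoʳ-≤ _ (sum-nonneg (f ∘ suc) (0≤f ∘ suc)) ⟩
    sum f                      ∎
  term≤sum {suc n} {f} 0≤f (suc i) = begin
    f (suc i)                  ≤⟨ term≤sum (0≤f ∘ suc) i ⟩
    sum (f ∘ suc)              ≈⟨ +-identityˡ _ ⟨
    0# + sum (f ∘ suc)         ≤⟨ +-mono-≤ (0≤f zero) ≤-refl ⟩
    sum f                      ∎

  -- Equality with 0 is decidable, so a nonzero term is found by going through the terms in order.
  sum≉0⇒term≉0 : ∀ {n} (f : Fin n → ℝ) → ¬ sum f ≈ 0# → ∃[ i ] ¬ f i ≈ 0#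
  sum≉0⇒term≉0 {zero}  f sum≉0 = ⊥-elim (sum≉0 ≈-refl)
  sum≉0⇒term≉0 {suc n} f sum≉0 with f zero ≟ 0#
  ... | no  f0≉0 = zero , f0≉0
  ... | yes f0≈0 with sum≉0⇒term≉0 (f ∘ suc)
                        (λ rest≈0 → sum≉0 (≈-trans (+-cong f0≈0 rest≈0) (+-identityˡ 0#)))
  ...   | i , fi≉0 = suc i , fi≉0

  open NonemptyFiniteSet using (enum; index)

  index-surjective : ∀ A (a : Elem A) → ∃[ i ] index A i ≡ a
  index-surjective A a = Inverse.from (enum A) a , Inverse.strictlyInverseˡ (enum A) a

  ∈-elements : ∀ A (a : Elem A) → a ∈ elements A
  ∈-elements A a with index-surjective A a
  ... | i , ≡.refl = ∈-tabulate⁺ {f = index A} i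

  ∑-mono-≤ : ∀ A {f h : Elem A → ℝ} → (∀ a → f a ≤ h a) → ∑ A f ≤ ∑ A h
  ∑-mono-≤ A f≤h = sum-mono-≤ (f≤h ∘ index A)

  term≤∑ : ∀ A {f : Elem A → ℝ} → (∀ a → 0# ≤ f a) → ∀ a → f a ≤ ∑ A f
  term≤∑ A 0≤f a with index-surjective A a
  ... | i , ≡.refl = term≤sum (0≤f ∘ index A) i

  ∑-pos : ∀ A {f : Elem A → ℝ} → (∀ a → 0# ≤ f a) → ∀ a → 0# < f a → 0# < ∑ A f
  ∑-pos A 0≤f a 0<fa = <-≤-trans 0<fa (term≤∑ A 0≤f a)

  ∑≉0⇒term≉0 : ∀ A (f : Elem A → ℝ) → ¬ ∑ A f ≈ 0# → ∃[ a ] ¬ f a ≈ 0#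
  ∑≉0⇒term≉0 A f ∑≉0 with sum≉0⇒term≉0 (f ∘ index A) ∑≉0
  ... | i , fi≉0 = index A i , fi≉0

  ∑-*ʳ : ∀ A x (f : Elem A → ℝ) → ∑[ a ∈ A ] f a * x ≈ ∑ A f * x
  ∑-*ʳ A x f = begin-equality
    ∑[ a ∈ A ] f a * x ≈⟨ ∑-cong A _ _ (λ a → *-comm (f a) x) ⟩
    ∑[ a ∈ A ] x * f a ≈⟨ ∑-*ˡ A x f ⟩
    x * ∑ A f          ≈⟨ *-comm x _ ⟩
    ∑ A f * x          ∎

  ∑-product : ∀ A B (f : Elem A → ℝ) (h : Elem B → ℝ) →
              ∑[ p ∈ A ⊗ B ] f (proj₁ p) * h (proj₂ p) ≈ ∑ A f * ∑ B h
  ∑-product A B f h = begin-equality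
    ∑[ p ∈ A ⊗ B ] f (proj₁ p) * h (proj₂ p) ≈⟨ ∑-⊗ A B (λ (a , b) → f a * h b) ⟩
    ∑[ a ∈ A ] ∑[ b ∈ B ] f a * h b          ≈⟨ ∑-cong A _ _ (λ a → ∑-*ˡ B (f a) h) ⟩
    ∑[ a ∈ A ] f a * ∑ B h                   ≈⟨ ∑-*ʳ A (∑ B h) f ⟩
    ∑ A f * ∑ B h                            ∎

  ∈⇒≤maximum : ∀ {x xs} → x ∈ xs → x ≤ maximum xs
  ∈⇒≤maximum {xs = y ∷ ys} (here ≡.refl) = ⊥≤max y ys
  ∈⇒≤maximum {xs = y ∷ ys} (there x∈ys)  = All.lookup (xs≤max y ys) x∈ys

  minimum≤∈ : ∀ {x xs} → x ∈ xs → minimum xs ≤ x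
  minimum≤∈ {xs = y ∷ ys} (here ≡.refl) = min≤⊤ y ys
  minimum≤∈ {xs = y ∷ ys} (there x∈ys)  = All.lookup (min≤xs y ys) x∈ys

  -- The membership assumed excludes the empty list, where `maximum` is a dummy.
  maximum∈ : ∀ {x xs} → x ∈ xs → maximum xs ∈ xs
  maximum∈ {xs = y ∷ ys} _ with argmax-sel (λ z → z) y ys
  ... | inj₁ max≡y  = here max≡y
  ... | inj₂ max∈ys = there max∈ys

  minimum∈ : ∀ {x xs} → x ∈ xs → minimum xs ∈ xs
  minimum∈ {xs = y ∷ ys} _ with argmin-sel (λ z → z) y ys
  ... | inj₁ min≡y  = here min≡y
  ... | inj₂ min∈ys = there min∈ys

  ≤Max : ∀ A (f : Elem A → ℝ) a → f a ≤ Max A f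
  ≤Max A f a = ∈⇒≤maximum (∈-map⁺ f (∈-elements A a))

  Max-attained : ∀ A (f : Elem A → ℝ) → ∃[ a ] Max A f ≡ f a
  Max-attained A f with ∈-map⁻ f (maximum∈ (∈-map⁺ f (∈-elements A (index A zero))))
  -- The element `index A zero` witnessed that the list of values is nonempty.
  ... | a , _ , Max≡fa = a , Max≡fa

  Max-nonneg : ∀ A (f : Elem A → ℝ) → (∀ a → 0# ≤ f a) → 0# ≤ Max A f
  Max-nonneg A f 0≤f = ≤-trans (0≤f (index A zero)) (≤Max A f (index A zero))

  -- Posterior vulnerability of a single channel.

  -- The gain of guess `w` on output `y`, not normalised by the probability of `y`; `Vᶜ` adds up its
  -- maxima over `w`.
  column : ∀ {W X Y} → GainFunction W X → Prior X → Channel X Y → Elem Y → Elem W → ℝ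
  column {X = X} g π C y w = ∑[ x ∈ X ] prob π x * entry C x y * gain g w x

  module _ {W X Y} (g : GainFunction W X) (π : Prior X) (C : Channel X Y) where

    term-nonneg : ∀ y w x → 0# ≤ prob π x * entry C x y * gain g w x
    term-nonneg y w x =
      *-nonneg (*-nonneg (Prior.nonneg π x) (Channel.nonneg C x y)) (GainFunction.nonneg g w x)

    column-nonneg : ∀ y w → 0# ≤ column g π C y w
    column-nonneg y w = ∑-nonneg X (term-nonneg y w)

    -- Row `x` of the channel sums to 1, so it has a nonzero entry at some `y`. The term at `y`, `w`
    -- and `x` is then positive, and all others are nonnegative.
    Vᶜ-pos : ∀ w x → ¬ prob π x * gain g w x ≈ 0# → 0# < Vᶜ g π C
    Vᶜ-pos w x πg≉0 with ∑≉0⇒term≉0 Y (entry C x) (λ ∑≈0 → 1≉0 (≈-trans (≈-sym (Channel.total C x)) ∑≈0))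
    ... | y , Cxy≉0 =
      ∑-pos Y (λ y → Max-nonneg W _ (column-nonneg y)) y
        (<-≤-trans (∑-pos X (term-nonneg y w) x
          (≉0⇒> (term-nonneg y w x) (*-≉0 (*-≉0 (*≉0⇒≉0ˡ πg≉0) Cxy≉0) (*≉0⇒≉0ʳ πg≉0))))
          (≤Max W (column g π C y) w))

  -- Provides the pair that makes `support` nonempty and from which all later positivity claims
  -- start.
  V-pos⇒support : ∀ {W X} (g : GainFunction W X) (π : Prior X) → 0# < V g π →
                  ∃[ w ] ∃[ x ] ¬ prob π x * gain g w x ≈ 0#
  V-pos⇒support {W} {X} g π 0<V with Max-attained W (λ w → ∑[ x ∈ X ] prob π x * gain g w x)
  ... | w , V≡ = w , ∑≉0⇒term≉0 X _ (λ ∑≈0 → <⇒≉0 0<V (≈-trans (≡⇒≈ V≡) ∑≈0))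

  -- Joint weights against products of marginal weights.

  module _ {X₁ X₂ Y₁ Y₂ W₁ W₂ : NonemptyFiniteSet}
           (g₁ : GainFunction W₁ X₁) (g₂ : GainFunction W₂ X₂)
           (g : GainFunction (W₁ ⊗ W₂) (X₁ ⊗ X₂)) (joint : JointGain g₁ g₂ g)
           (π : Prior (X₁ ⊗ X₂)) (C₁ : Channel X₁ Y₁) (C₂ : Channel X₂ Y₂) where

    π₁ : Prior X₁
    π₁ = marginal₁ X₁ X₂ π

    π₂ : Prior X₂
    π₂ = marginal₂ X₁ X₂ π

    weight : Elem (W₁ ⊗ W₂) → Elem (X₁ ⊗ X₂) → ℝ
    weight w x = prob π x * gain g w x

    weight₁ : Elem W₁ → Elem X₁ → ℝ
    weight₁ w x = prob π₁ x * gain g₁ w x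

    weight₂ : Elem W₂ → Elem X₂ → ℝ
    weight₂ w x = prob π₂ x * gain g₂ w x

    weight-nonneg : ∀ w x → 0# ≤ weight w x
    weight-nonneg w x = *-nonneg (Prior.nonneg π x) (GainFunction.nonneg g w x)

    weight₁-nonneg : ∀ w x → 0# ≤ weight₁ w x
    weight₁-nonneg w x = *-nonneg (Prior.nonneg π₁ x) (GainFunction.nonneg g₁ w x)

    weight₂-nonneg : ∀ w x → 0# ≤ weight₂ w x
    weight₂-nonneg w x = *-nonneg (Prior.nonneg π₂ x) (GainFunction.nonneg g₂ w x)

    -- The test by which `support` is filtered, named so that the membership lemmas for `filter` can
    -- refer to it.
    weight≉0? : (p : Elem (W₁ ⊗ W₂) × Elem (X₁ ⊗ X₂)) → Dec (¬ weight (proj₁ p) (proj₂ p) ≈ 0#)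
    weight≉0? (w , x) = ¬? (weight w x ≟ 0#)

    ∈-support : ∀ w x → ¬ weight w x ≈ 0# → (w , x) ∈ support g₁ g₂ g π
    ∈-support w x = ∈-filter⁺ weight≉0?
      (∈-cartesianProduct⁺ (∈-elements (W₁ ⊗ W₂) w) (∈-elements (X₁ ⊗ X₂) x))

    weight*ratio : ∀ w₁ w₂ x₁ x₂ → ¬ weight (w₁ , w₂) (x₁ , x₂) ≈ 0# →
      weight (w₁ , w₂) (x₁ , x₂) * ratio g₁ g₂ g π ((w₁ , w₂) , (x₁ , x₂)) ≈ weight₁ w₁ x₁ * weight₂ w₂ x₂
    weight*ratio w₁ w₂ x₁ x₂ = x*[y÷x]≈y _ _

    -- A positive prior at `x` makes both marginals positive there, and `JointGain` passes
    -- nonvanishing from `g` to `g₁` and `g₂`.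
    ratio-pos : ∀ w x → ¬ weight w x ≈ 0# → 0# < ratio g₁ g₂ g π (w , x)
    ratio-pos w@(w₁ , w₂) x@(x₁ , x₂) πg≉0 =
      *-pos (*-pos (*-pos 0<π₁ 0<g₁) (*-pos 0<π₂ 0<g₂)) (⁻¹-pos (≉0⇒> (weight-nonneg w x) πg≉0))
      where
      0<π : 0# < prob π x
      0<π = ≉0⇒> (Prior.nonneg π x) (*≉0⇒≉0ˡ πg≉0)

      g₁g₂≉0 : ¬ gain g₁ w₁ x₁ * gain g₂ w₂ x₂ ≈ 0#
      g₁g₂≉0 = *≉0⇒≉0ʳ πg≉0 ∘ Equivalence.from (joint w₁ w₂ x₁ x₂)

      0<π₁ : 0# < prob π₁ x₁
      0<π₁ = ∑-pos X₂ (λ x₂ → Prior.nonneg π (x₁ , x₂)) x₂ 0<π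

      0<π₂ : 0# < prob π₂ x₂
      0<π₂ = ∑-pos X₁ (λ x₁ → Prior.nonneg π (x₁ , x₂)) x₁ 0<π

      0<g₁ : 0# < gain g₁ w₁ x₁
      0<g₁ = ≉0⇒> (GainFunction.nonneg g₁ w₁ x₁) (*≉0⇒≉0ˡ g₁g₂≉0)

      0<g₂ : 0# < gain g₂ w₂ x₂
      0<g₂ = ≉0⇒> (GainFunction.nonneg g₂ w₂ x₂) (*≉0⇒≉0ʳ g₁g₂≉0)

    ∈-ratios-pos : ∀ {r} → r ∈ map (ratio g₁ g₂ g π) (support g₁ g₂ g π) → 0# < r
    ∈-ratios-pos r∈ with ∈-map⁻ (ratio g₁ g₂ g π) r∈
    ... | (w , x) , wx∈ , ≡.refl = ratio-pos w x (proj₂ (∈-filter⁻ weight≉0?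
            {xs = cartesianProduct (elements (W₁ ⊗ W₂)) (elements (X₁ ⊗ X₂))} wx∈))

    M-min-pos : ∀ w x → ¬ weight w x ≈ 0# → 0# < M-min g₁ g₂ g π
    M-min-pos w x πg≉0 = ∈-ratios-pos (minimum∈ (∈-map⁺ _ (∈-support w x πg≉0)))

    M-max-pos : ∀ w x → ¬ weight w x ≈ 0# → 0# < M-max g₁ g₂ g π
    M-max-pos w x πg≉0 = ∈-ratios-pos (maximum∈ (∈-map⁺ _ (∈-support w x πg≉0)))

    weight*M-min≤ : ∀ w₁ w₂ x₁ x₂ →
      weight (w₁ , w₂) (x₁ , x₂) * M-min g₁ g₂ g π ≤ weight₁ w₁ x₁ * weight₂ w₂ x₂
    weight*M-min≤ w₁ w₂ x₁ x₂ with weight (w₁ , w₂) (x₁ , x₂) ≟ 0#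
    ... | yes πg≈0 = begin
      weight (w₁ , w₂) (x₁ , x₂) * M-min g₁ g₂ g π ≈⟨ *-congʳ πg≈0 ⟩
      0# * M-min g₁ g₂ g π                         ≈⟨ zeroˡ _ ⟩
      0#                                           ≤⟨ *-nonneg (weight₁-nonneg w₁ x₁) (weight₂-nonneg w₂ x₂) ⟩
      weight₁ w₁ x₁ * weight₂ w₂ x₂                ∎
    ... | no  πg≉0 = begin
      weight (w₁ , w₂) (x₁ , x₂) * M-min g₁ g₂ g π
        ≤⟨ *-monoˡ-≤ (weight-nonneg _ _) (minimum≤∈ (∈-map⁺ _ (∈-support _ _ πg≉0))) ⟩
      weight (w₁ , w₂) (x₁ , x₂) * ratio g₁ g₂ g π ((w₁ , w₂) , (x₁ , x₂))
        ≈⟨ weight*ratio w₁ w₂ x₁ x₂ πg≉0 ⟩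
      weight₁ w₁ x₁ * weight₂ w₂ x₂ ∎

    ≤weight*M-max : JointlySupported X₁ X₂ π → ∀ w₁ w₂ x₁ x₂ →
      weight₁ w₁ x₁ * weight₂ w₂ x₂ ≤ weight (w₁ , w₂) (x₁ , x₂) * M-max g₁ g₂ g π
    ≤weight*M-max supported w₁ w₂ x₁ x₂ with weight₁ w₁ x₁ * weight₂ w₂ x₂ ≟ 0#
                                            | weight (w₁ , w₂) (x₁ , x₂) ≟ 0#
    ... | _ | no πg≉0 = begin
      weight₁ w₁ x₁ * weight₂ w₂ x₂
        ≈⟨ weight*ratio w₁ w₂ x₁ x₂ πg≉0 ⟨
      weight (w₁ , w₂) (x₁ , x₂) * ratio g₁ g₂ g π ((w₁ , w₂) , (x₁ , x₂))
        ≤⟨ *-monoˡ-≤ (weight-nonneg _ _) (∈⇒≤maximum (∈-map⁺ _ (∈-support _ _ πg≉0))) ⟩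
      weight (w₁ , w₂) (x₁ , x₂) * M-max g₁ g₂ g π ∎
    ... | yes product≈0 | yes πg≈0 = ≈⇒≤ (≈-trans product≈0
            (≈-sym (≈-trans (*-congʳ πg≈0) (zeroˡ _))))
    ... | no product≉0 | yes πg≈0 = ⊥-elim (*-≉0 π≉0 g≉0 πg≈0)
      where
      -- Grouping priors with priors and gains with gains fits the forms of `JointlySupported` and
      -- `JointGain`.
      rearranged≉0 : ¬ prob π₁ x₁ * prob π₂ x₂ * (gain g₁ w₁ x₁ * gain g₂ w₂ x₂) ≈ 0#
      rearranged≉0 = product≉0 ∘ ≈-trans (*-interchange _ _ _ _)

      π≉0 : ¬ prob π (x₁ , x₂) ≈ 0#
      π≉0 = supported x₁ x₂ (*≉0⇒≉0ˡ rearranged≉0)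

      g≉0 : ¬ gain g (w₁ , w₂) (x₁ , x₂) ≈ 0#
      g≉0 = *≉0⇒≉0ʳ rearranged≉0 ∘ Equivalence.to (joint w₁ w₂ x₁ x₂)

    -- Comparison of vulnerabilities, output by output.

    column₁ : Elem Y₁ → Elem W₁ → ℝ
    column₁ = column g₁ π₁ C₁

    column₂ : Elem Y₂ → Elem W₂ → ℝ
    column₂ = column g₂ π₂ C₂

    column× : Elem (Y₁ ⊗ Y₂) → Elem (W₁ ⊗ W₂) → ℝ
    column× = column g π (C₁ ∥ C₂)

    entries : Elem (Y₁ ⊗ Y₂) → Elem (X₁ ⊗ X₂) → ℝ
    entries y x = entry (C₁ ∥ C₂) x y

    entries-nonneg : ∀ y x → 0# ≤ entries y x
    entries-nonneg y x = Channel.nonneg (C₁ ∥ C₂) x y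

    -- This and `column-product` expand over `X₁ ⊗ X₂` with the same nonnegative coefficients
    -- `entries`, so that only the weights remain to be compared.
    column×-*ʳ : ∀ y w m → column× y w * m ≈ ∑[ x ∈ X₁ ⊗ X₂ ] entries y x * (weight w x * m)
    column×-*ʳ y w m = ≈-trans
      (≈-sym (∑-*ʳ (X₁ ⊗ X₂) m (λ x → prob π x * entries y x * gain g w x)))
      (∑-cong (X₁ ⊗ X₂) _ _ λ x →
        solve 4 (λ p e γ m → p :* e :* γ :* m := e :* (p :* γ :* m)) ≈-refl
          (prob π x) (entries y x) (gain g w x) m)

    column-product : ∀ y₁ y₂ w₁ w₂ → column₁ y₁ w₁ * column₂ y₂ w₂
      ≈ ∑[ x ∈ X₁ ⊗ X₂ ] entries (y₁ , y₂) x * (weight₁ w₁ (proj₁ x) * weight₂ w₂ (proj₂ x))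
    column-product y₁ y₂ w₁ w₂ = ≈-trans
      (≈-sym (∑-product X₁ X₂
        (λ x₁ → prob π₁ x₁ * entry C₁ x₁ y₁ * gain g₁ w₁ x₁)
        (λ x₂ → prob π₂ x₂ * entry C₂ x₂ y₂ * gain g₂ w₂ x₂)))
      (∑-cong (X₁ ⊗ X₂) _ _ λ (x₁ , x₂) →
        solve 6 (λ p e γ p′ e′ γ′ → p :* e :* γ :* (p′ :* e′ :* γ′)
          := e :* e′ :* (p :* γ :* (p′ :* γ′))) ≈-refl
          (prob π₁ x₁) (entry C₁ x₁ y₁) (gain g₁ w₁ x₁)
          (prob π₂ x₂) (entry C₂ x₂ y₂) (gain g₂ w₂ x₂))

    -- Indexes the product by the outputs of the parallel channel, as the joint vulnerability is.
    Vᶜ-product : Vᶜ g₁ π₁ C₁ * Vᶜ g₂ π₂ C₂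
      ≈ ∑[ y ∈ Y₁ ⊗ Y₂ ] Max W₁ (column₁ (proj₁ y)) * Max W₂ (column₂ (proj₂ y))
    Vᶜ-product = ≈-sym (∑-product Y₁ Y₂ (λ y₁ → Max W₁ (column₁ y₁)) (λ y₂ → Max W₂ (column₂ y₂)))

    Vᶜ*M-min≤ : Vᶜ g π (C₁ ∥ C₂) * M-min g₁ g₂ g π ≤ Vᶜ g₁ π₁ C₁ * Vᶜ g₂ π₂ C₂
    Vᶜ*M-min≤ = begin
      Vᶜ g π (C₁ ∥ C₂) * m
        ≈⟨ ∑-*ʳ (Y₁ ⊗ Y₂) m (λ y → Max (W₁ ⊗ W₂) (column× y)) ⟨
      ∑[ y ∈ Y₁ ⊗ Y₂ ] Max (W₁ ⊗ W₂) (column× y) * m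
        ≤⟨ ∑-mono-≤ (Y₁ ⊗ Y₂) (λ (y₁ , y₂) → columnwise y₁ y₂) ⟩
      ∑[ y ∈ Y₁ ⊗ Y₂ ] Max W₁ (column₁ (proj₁ y)) * Max W₂ (column₂ (proj₂ y))
        ≈⟨ Vᶜ-product ⟨
      Vᶜ g₁ π₁ C₁ * Vᶜ g₂ π₂ C₂ ∎
      where
      m : ℝ
      m = M-min g₁ g₂ g π

      columnwise : ∀ y₁ y₂ → Max (W₁ ⊗ W₂) (column× (y₁ , y₂)) * m ≤ Max W₁ (column₁ y₁) * Max W₂ (column₂ y₂)
      -- The components of an optimal joint guess are admissible, though perhaps not optimal, for
      -- the single channels.
      columnwise y₁ y₂ with Max-attained (W₁ ⊗ W₂) (column× (y₁ , y₂))
      ... | (w₁ , w₂) , Max≡ = begin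
        Max (W₁ ⊗ W₂) (column× (y₁ , y₂)) * m
          ≈⟨ *-congʳ (≡⇒≈ Max≡) ⟩
        column× (y₁ , y₂) (w₁ , w₂) * m
          ≈⟨ column×-*ʳ (y₁ , y₂) (w₁ , w₂) m ⟩
        ∑[ x ∈ X₁ ⊗ X₂ ] entries (y₁ , y₂) x * (weight (w₁ , w₂) x * m)
          ≤⟨ ∑-mono-≤ (X₁ ⊗ X₂) (λ (x₁ , x₂) →
               *-monoˡ-≤ (entries-nonneg (y₁ , y₂) (x₁ , x₂)) (weight*M-min≤ w₁ w₂ x₁ x₂)) ⟩
        ∑[ x ∈ X₁ ⊗ X₂ ] entries (y₁ , y₂) x * (weight₁ w₁ (proj₁ x) * weight₂ w₂ (proj₂ x))
          ≈⟨ column-product y₁ y₂ w₁ w₂ ⟨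
        column₁ y₁ w₁ * column₂ y₂ w₂
          ≤⟨ *-mono-≤ (column-nonneg g₁ π₁ C₁ y₁ w₁) (Max-nonneg W₂ _ (column-nonneg g₂ π₂ C₂ y₂))
               (≤Max W₁ (column₁ y₁) w₁) (≤Max W₂ (column₂ y₂) w₂) ⟩
        Max W₁ (column₁ y₁) * Max W₂ (column₂ y₂) ∎

    ≤Vᶜ*M-max : JointlySupported X₁ X₂ π → 0# ≤ M-max g₁ g₂ g π →
      Vᶜ g₁ π₁ C₁ * Vᶜ g₂ π₂ C₂ ≤ Vᶜ g π (C₁ ∥ C₂) * M-max g₁ g₂ g π
    ≤Vᶜ*M-max supported 0≤m = begin
      Vᶜ g₁ π₁ C₁ * Vᶜ g₂ π₂ C₂
        ≈⟨ Vᶜ-product ⟩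
      ∑[ y ∈ Y₁ ⊗ Y₂ ] Max W₁ (column₁ (proj₁ y)) * Max W₂ (column₂ (proj₂ y))
        ≤⟨ ∑-mono-≤ (Y₁ ⊗ Y₂) (λ (y₁ , y₂) → columnwise y₁ y₂) ⟩
      ∑[ y ∈ Y₁ ⊗ Y₂ ] Max (W₁ ⊗ W₂) (column× y) * m
        ≈⟨ ∑-*ʳ (Y₁ ⊗ Y₂) m (λ y → Max (W₁ ⊗ W₂) (column× y)) ⟩
      Vᶜ g π (C₁ ∥ C₂) * m ∎
      where
      m : ℝ
      m = M-max g₁ g₂ g π

      columnwise : ∀ y₁ y₂ → Max W₁ (column₁ y₁) * Max W₂ (column₂ y₂) ≤ Max (W₁ ⊗ W₂) (column× (y₁ , y₂)) * m
      -- Conversely, optimal guesses for the single channels form an admissible joint guess.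
      columnwise y₁ y₂ with Max-attained W₁ (column₁ y₁) | Max-attained W₂ (column₂ y₂)
      ... | w₁ , Max₁≡ | w₂ , Max₂≡ = begin
        Max W₁ (column₁ y₁) * Max W₂ (column₂ y₂)
          ≈⟨ *-cong (≡⇒≈ Max₁≡) (≡⇒≈ Max₂≡) ⟩
        column₁ y₁ w₁ * column₂ y₂ w₂
          ≈⟨ column-product y₁ y₂ w₁ w₂ ⟩
        ∑[ x ∈ X₁ ⊗ X₂ ] entries (y₁ , y₂) x * (weight₁ w₁ (proj₁ x) * weight₂ w₂ (proj₂ x))
          ≤⟨ ∑-mono-≤ (X₁ ⊗ X₂) (λ (x₁ , x₂) →
               *-monoˡ-≤ (entries-nonneg (y₁ , y₂) (x₁ , x₂)) (≤weight*M-max supported w₁ w₂ x₁ x₂)) ⟩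
        ∑[ x ∈ X₁ ⊗ X₂ ] entries (y₁ , y₂) x * (weight (w₁ , w₂) x * m)
          ≈⟨ column×-*ʳ (y₁ , y₂) (w₁ , w₂) m ⟨
        column× (y₁ , y₂) (w₁ , w₂) * m
          -- Passing to the maximum under the factor `m` keeps the order because `m` is nonnegative.
          ≤⟨ *-mono-≤ (column-nonneg g π (C₁ ∥ C₂) _ _) 0≤m (≤Max (W₁ ⊗ W₂) (column× (y₁ , y₂)) (w₁ , w₂)) ≤-refl ⟩
        Max (W₁ ⊗ W₂) (column× (y₁ , y₂)) * m ∎

    -- A single pair of nonzero weight makes the argument of every logarithm involved positive, so
    -- that `log₂-*-mono-≤` applies to both comparisons.
    H-bounds : 0# < V g π →
      (H g₁ π₁ C₁ + H g₂ π₂ C₂ + log₂ (M-min g₁ g₂ g π) ≤ H g π (C₁ ∥ C₂)) ×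
      (JointlySupported X₁ X₂ π →
       H g π (C₁ ∥ C₂) ≤ H g₁ π₁ C₁ + H g₂ π₂ C₂ + log₂ (M-max g₁ g₂ g π))
    H-bounds 0<V with V-pos⇒support g π 0<V
    ... | w@(w₁ , w₂) , x@(x₁ , x₂) , πg≉0 =
      v+m≤a+b⇒-a-b+m≤-v (log₂-*-mono-≤ 0<Vᶜ 0<M-min 0<V₁ 0<V₂ Vᶜ*M-min≤) ,
      λ supported → a+b≤v+m⇒-v≤-a-b+m
        (log₂-*-mono-≤ 0<V₁ 0<V₂ 0<Vᶜ 0<M-max (≤Vᶜ*M-max supported (proj₁ 0<M-max)))
      where
      0<M-min : 0# < M-min g₁ g₂ g π
      0<M-min = M-min-pos w x πg≉0

      0<M-max : 0# < M-max g₁ g₂ g π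
      0<M-max = M-max-pos w x πg≉0

      0<Vᶜ : 0# < Vᶜ g π (C₁ ∥ C₂)
      0<Vᶜ = Vᶜ-pos g π (C₁ ∥ C₂) w x πg≉0

      -- A ratio that does not vanish has a numerator that does not vanish.
      weights≉0 : ¬ weight₁ w₁ x₁ * weight₂ w₂ x₂ ≈ 0#
      weights≉0 = *≉0⇒≉0ˡ (<⇒≉0 (ratio-pos w x πg≉0))

      0<V₁ : 0# < Vᶜ g₁ π₁ C₁
      0<V₁ = Vᶜ-pos g₁ π₁ C₁ w₁ x₁ (*≉0⇒≉0ˡ weights≉0)

      0<V₂ : 0# < Vᶜ g₂ π₂ C₂
      0<V₂ = Vᶜ-pos g₂ π₂ C₂ w₂ x₂ (*≉0⇒≉0ʳ weights≉0)

lemma3p7 : ∀ {c ℓ} (R : Reals c ℓ) → let open Leakage R in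
    (X₁ X₂ Y₁ Y₂ W₁ W₂ : NonemptyFiniteSet)
    (g₁ : GainFunction W₁ X₁) (g₂ : GainFunction W₂ X₂)
    (g : GainFunction (W₁ ⊗ W₂) (X₁ ⊗ X₂)) → JointGain g₁ g₂ g →
    (π : Prior (X₁ ⊗ X₂)) → 0# < V g π →
    (C₁ : Channel X₁ Y₁) (C₂ : Channel X₂ Y₂) →
    (H g₁ (marginal₁ X₁ X₂ π) C₁ + H g₂ (marginal₂ X₁ X₂ π) C₂ + log₂ (M-min g₁ g₂ g π)
    ≤ H g π (C₁ ∥ C₂))
    ×
    (JointlySupported X₁ X₂ π →
    H g π (C₁ ∥ C₂)
    ≤ H g₁ (marginal₁ X₁ X₂ π) C₁ + H g₂ (marginal₂ X₁ X₂ π) C₂ + log₂ (M-max g₁ g₂ g π))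
lemma3p7 R X₁ X₂ Y₁ Y₂ W₁ W₂ g₁ g₂ g joint π 0<V C₁ C₂ = H-bounds R g₁ g₂ g joint π C₁ C₂ 0<V
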